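{- Let $G$ be a finite simple graph with at least one edge such that $\chi(G) \in \{\Delta(G), \Delta(G)+1\}$, where $\chi(G)$ is the chromatic number and $\Delta(G)$ the maximum degree of $G$. Then ${\rm vs}_{\chi}(G) = {\rm ivs}_{\chi}(G)$.
   Context: All graphs are finite, simple, and have at least one edge. The chromatic vertex stability number ${\rm vs}_{\chi}(G)$ is the minimum number of vertices of $G$ whose deletion results in a graph $H$ with $\chi(H) = \chi(G)-1$. The independent chromatic vertex stability number ${\rm ivs}_{\chi}(G)$ is the minimum cardinality of an independent set of vertices of $G$ whose deletion results in a graph $H$ with $\chi(H) = \chi(G)-1$. -}

module Defs where

open import Data.Nat using (ℕ; zero; suc; _≤_; _∸_; _⊔_)
open import Data.Bool using (Bool; true; false; if_then_else_)
open import Data.Fin using (Fin)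
open import Data.Fin.Subset using (Subset; _∈_; _∉_; ∣_∣)
open import Data.List using (List; foldr; map; filter; length; allFin)
open import Data.Product using (Σ; _×_; ∃; ∃-syntax)
open import Relation.Binary.PropositionalEquality using (_≡_; _≢_)
open import Relation.Nullary using (¬_)

record Graph (n : ℕ) : Set where
  field
    adj    : Fin n → Fin n → Bool
    sym    : ∀ u v → adj u v ≡ adj v u
    irrefl : ∀ v → adj v v ≡ false
open Graph public

Adj : ∀ {n} → Graph n → Fin n → Fin n → Set
Adj G u v = adj G u v ≡ true

HasEdge : ∀ {n} → Graph n → Set
HasEdge G = ∃[ u ] ∃[ v ] Adj G u v

degree : ∀ {n} → Graph n → Fin n → ℕ
degree {n} G v = length (filter (λ u → Data.Bool._≟_ (adj G v u) true) (allFin n))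
  where import Data.Bool

maxDegree : ∀ {n} → Graph n → ℕ
maxDegree {n} G = foldr _⊔_ 0 (map (degree G) (allFin n))

ColorableMinus : ∀ {n} → Graph n → Subset n → ℕ → Set
ColorableMinus {n} G S k =
  Σ (Fin n → Fin k) λ c → ∀ u v → u ∉ S → v ∉ S → Adj G u v → c u ≢ c v

ChromaticMinus : ∀ {n} → Graph n → Subset n → ℕ → Set
ChromaticMinus G S k = ColorableMinus G S k × (∀ j → ColorableMinus G S j → k ≤ j)

∅ : ∀ {n} → Subset n
∅ = Data.Fin.Subset.⊥
  where import Data.Fin.Subset

Chromatic : ∀ {n} → Graph n → ℕ → Set
Chromatic G k = ChromaticMinus G ∅ k

Independent : ∀ {n} → Graph n → Subset n → Set
Independent G S = ∀ u v → u ∈ S → v ∈ S → ¬ Adj G u v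

Reduces : ∀ {n} → Graph n → Subset n → Set
Reduces G S = ∀ k → Chromatic G k → ChromaticMinus G S (k ∸ 1)

IsVS : ∀ {n} → Graph n → ℕ → Set
IsVS {n} G m =
  (∃[ S ] (∣ S ∣ ≡ m × Reduces G S)) ×
  (∀ (S : Subset n) → Reduces G S → m ≤ ∣ S ∣)

IsIVS : ∀ {n} → Graph n → ℕ → Set
IsIVS {n} G m =
  (∃[ S ] (∣ S ∣ ≡ m × Independent G S × Reduces G S)) ×
  (∀ (S : Subset n) → Independent G S → Reduces G S → m ≤ ∣ S ∣)

{-# OPTIONS --safe #-}
-- Encode a vertex set S together with a (k − 1)-colouring of G − S as a map
-- c : V → Fin k whose zero class is S and which is proper outside S.  Take S of
-- minimum size and suppose u, v ∈ S are adjacent.  By minimality u sees every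
-- nonzero colour; it also sees v and has degree at most Δ ≤ k, so it sees every
-- nonzero colour exactly once.  Hence, if x is the neighbour of u of colour i ≠ 0,
-- giving u the colour i and moving x into S is again admissible and preserves ∣S∣.
-- Fix a proper k-colouring f of G.  As f u ≢ f v, one may assume f u ≢ 0 and take
-- i = f u.  Then u becomes a vertex on which c and f agree, while x was not one,
-- because c x ≡ f u ≢ f x.  So c agrees with f on a strictly larger set than
-- before, and iterating must end with S independent.
module Submission where

open import Defs hiding (sym)
open import Data.Nat using (ℕ; zero; suc; _≤_; _^_; s≤s; s≤s⁻¹; _⊔_)
open import Data.Nat.Properties
  using (≤-trans; ≤-refl; ≤-reflexive; ≤-antisym; <⇒≱; n≤1+n; m≤m⊔n; m≤n⊔m; ≤-totalOrder;
         module ≤-Reasoning)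
import Data.Bool as Bool
open import Data.Fin using (Fin; zero; suc; _≟_; finToFun; funToFin)
open import Data.Fin.Properties using (any?; all?; suc-injective; injective⇒≤; finToFun-funToFin)
open import Data.Fin.Subset using (Subset; _∈_; _∉_; _⊆_; _⊃_; ∣_∣; _-_; inside; outside)
open import Data.Fin.Subset.Induction using (⊃-wellFounded; Acc; acc)
open import Data.Fin.Subset.Properties
  using (_∈?_; ∉⊥; p─⊥≡p; p⊆q⇒∣p∣≤∣q∣; p⊂q⇒∣p∣<∣q∣; p─q⊆p; x∈p∧x≢y⇒x∈p-y; x∈p⇒∣p-x∣<∣p∣)
open import Data.List using (List; allFin; filter; foldr; length)
import Data.List.Extrema ≤-totalOrder as Extrema
import Data.List.Membership.Propositional as List
open import Data.List.Membership.Propositional.Properties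
  using (∈-allFin; ∈-filter⁺; ∈-map⁺)
import Data.List.Membership.Setoid.Properties as Membership
open import Data.List.Relation.Unary.All.Properties using (all-filter)
open import Data.List.Relation.Unary.Any using (here; there; index)
open import Data.Product using (_×_; _,_; ∃-syntax; proj₁; proj₂)
open import Data.Sum using (_⊎_; inj₂; [_,_]′)
open import Data.Vec using (_∷_; tabulate; there)
open import Data.Vec.Properties using ([]=⇒lookup; lookup⇒[]=; lookup∘tabulate)
open import Data.Vec.Functional using (updateAt)
open import Data.Vec.Functional.Properties using (updateAt-updates; updateAt-minimal)
open import Function using (_∘_; const)
open import Function.Definitions using (Injective)
open import Relation.Binary.PropositionalEquality
  using (_≡_; _≢_; refl; sym; trans; cong; setoid)
open import Relation.Nullary using (¬_; Dec; yes; no; does; contradiction)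
open import Relation.Nullary.Decidable using (_×-dec_; _→-dec_; dec-true)
open import Relation.Unary using (Pred; Decidable)

-- Comprehension subsets and counting

module _ {n p} {P : Pred (Fin n) p} (P? : Decidable P) where

  comprehension : Subset n
  comprehension = tabulate (does ∘ P?)

  ∈-comprehension⁺ : ∀ {x} → P x → x ∈ comprehension
  ∈-comprehension⁺ {x} px =
    lookup⇒[]= x _ (trans (lookup∘tabulate _ x) (dec-true (P? x) px))

  ∈-comprehension⁻ : ∀ {x} → x ∈ comprehension → P x
  ∈-comprehension⁻ {x} x∈ with P? x | trans (sym (lookup∘tabulate (does ∘ P?) x)) ([]=⇒lookup x∈)
  ... | yes px | _ = px
  ... | no  _  | ()

  -- Equal positions in the filtered list hold equal entries, so sending `i` to the position of
  -- `h i` is injective. With `P` adjacency to a vertex, this bounds its degree from below.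
  injective⇒≤length-filter : ∀ {m} {h : Fin m → Fin n} → Injective _≡_ _≡_ h →
    (∀ i → P (h i)) → m ≤ length (filter P? (allFin n))
  injective⇒≤length-filter {h = h} h-inj Ph =
    injective⇒≤ {f = λ i → index (pos i)}
      (λ {i} {j} eq → h-inj (Membership.index-injective (setoid _) (pos i) (pos j) eq))
    where
    pos : ∀ i → h i List.∈ filter P? (allFin n)
    pos i = ∈-filter⁺ P? (∈-allFin (h i)) (Ph i)

∣p∣≤1+∣p-x∣ : ∀ {n} (p : Subset n) x → ∣ p ∣ ≤ suc ∣ p - x ∣
∣p∣≤1+∣p-x∣ (inside  ∷ p) zero    = s≤s (≤-reflexive (cong ∣_∣ (sym (p─⊥≡p p))))
∣p∣≤1+∣p-x∣ (outside ∷ p) zero    = ≤-trans (≤-reflexive (cong ∣_∣ (sym (p─⊥≡p p)))) (n≤1+n _)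
∣p∣≤1+∣p-x∣ (inside  ∷ p) (suc x) = s≤s (∣p∣≤1+∣p-x∣ p x)
∣p∣≤1+∣p-x∣ (outside ∷ p) (suc x) = ∣p∣≤1+∣p-x∣ p x

x∉p-x : ∀ {n} (p : Subset n) x → x ∉ p - x
x∉p-x (_ ∷ p) (suc x) (there x∈) = x∉p-x p x x∈

∈⇒≤foldr-⊔ : ∀ {m xs} → m List.∈ xs → m ≤ foldr _⊔_ 0 xs
∈⇒≤foldr-⊔ (here refl)               = m≤m⊔n _ _
∈⇒≤foldr-⊔ (there {x = x} {xs} m∈xs) = ≤-trans (∈⇒≤foldr-⊔ m∈xs) (m≤n⊔m x _)

degree≤maxDegree : ∀ {n} (G : Graph n) v → degree G v ≤ maxDegree G
degree≤maxDegree G v = ∈⇒≤foldr-⊔ (∈-map⁺ (degree G) (∈-allFin v))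

-- Recolouring, zero classes and agreement sets

recolour : ∀ {n k} → (Fin n → Fin k) → Fin n → Fin k → Fin n → Fin k
recolour c u i = updateAt c u (const i)

zeros : ∀ {n k} → (Fin n → Fin (suc k)) → Subset n
zeros c = comprehension (λ v → c v ≟ zero)

∈-zeros⁺ : ∀ {n k} (c : Fin n → Fin (suc k)) {v} → c v ≡ zero → v ∈ zeros c
∈-zeros⁺ c = ∈-comprehension⁺ (λ v → c v ≟ zero)

∈-zeros⁻ : ∀ {n k} (c : Fin n → Fin (suc k)) {v} → v ∈ zeros c → c v ≡ zero
∈-zeros⁻ c = ∈-comprehension⁻ (λ v → c v ≟ zero)

-- Needed because a decoded colouring is only pointwise equal to the one encoded.
zeros-cong : ∀ {n k} {c d : Fin n → Fin (suc k)} → (∀ v → c v ≡ d v) → zeros c ⊆ zeros d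
zeros-cong {c = c} {d} c≗d {v} =
  ∈-zeros⁺ d ∘ trans (sym (c≗d v)) ∘ ∈-zeros⁻ c

agreement : ∀ {n k} → (Fin n → Fin k) → (Fin n → Fin k) → Subset n
agreement f c = comprehension (λ v → c v ≟ f v)

∈-agreement⁺ : ∀ {n k} (f c : Fin n → Fin k) {v} → c v ≡ f v → v ∈ agreement f c
∈-agreement⁺ f c = ∈-comprehension⁺ (λ v → c v ≟ f v)

∈-agreement⁻ : ∀ {n k} (f c : Fin n → Fin k) {v} → v ∈ agreement f c → c v ≡ f v
∈-agreement⁻ f c = ∈-comprehension⁻ (λ v → c v ≟ f v)

-- Colourings proper off the zero class

module _ {n} (G : Graph n) where

  Adj-sym : ∀ {u v} → Adj G u v → Adj G v u
  Adj-sym {u} {v} = trans (Graph.sym G v u)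

  Adj-irrefl : ∀ {v} → ¬ Adj G v v
  Adj-irrefl {v} a with trans (sym a) (irrefl G v)
  ... | ()

  Adj⇒≢ : ∀ {u v} → Adj G u v → v ≢ u
  Adj⇒≢ a refl = Adj-irrefl a

  Adj? : ∀ u v → Dec (Adj G u v)
  Adj? u v = adj G u v Bool.≟ Bool.true

  -- With `suc k` the chromatic number, `c` has the same type as a proper colouring of `G`, so the
  -- two can be compared vertex by vertex.
  ProperOffZero : ∀ {k} → (Fin n → Fin (suc k)) → Set
  ProperOffZero c = ∀ u v → Adj G u v → c u ≡ c v → c u ≡ zero

  properOffZero? : ∀ {k} (c : Fin n → Fin (suc k)) → Dec (ProperOffZero c)
  properOffZero? c =
    all? λ u → all? λ v → Adj? u v →-dec ((c u ≟ c v) →-dec (c u ≟ zero))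

  ZeroMinimal : ∀ {k} → (Fin n → Fin (suc k)) → Set
  ZeroMinimal {k} c = ∀ (d : Fin n → Fin (suc k)) → ProperOffZero d → ∣ zeros c ∣ ≤ ∣ zeros d ∣

  -- Colourings are numbered by `Fin (suc k ^ n)`, which makes the admissible ones a finite list to
  -- minimise over.
  ∃-zeroMinimal : ∀ {k} {f : Fin n → Fin (suc k)} → ProperOffZero f →
    ∃[ c ] (ProperOffZero {k} c × ZeroMinimal c)
  ∃-zeroMinimal {k} {f} f-proper = finToFun best , best-proper , best-minimal
    where
    Code = Fin (suc k ^ n)

    decode : Code → Fin n → Fin (suc k)
    decode = finToFun

    proper? : Decidable (ProperOffZero ∘ decode)
    proper? = properOffZero? ∘ decode

    encode-proper : ∀ d → ProperOffZero d → ProperOffZero (decode (funToFin d))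
    encode-proper d d-proper u v a
      rewrite finToFun-funToFin d u | finToFun-funToFin d v = d-proper u v a

    size : Code → ℕ
    size = ∣_∣ ∘ zeros ∘ decode

    codes : List Code
    codes = filter proper? (allFin _)

    best : Code
    -- `funToFin f` is the default value of `argmin` and may be returned, so it has to be admissible
    -- itself.
    best = Extrema.argmin size (funToFin f) codes

    best-proper : ProperOffZero (decode best)
    best-proper = Extrema.argmin-all size {P = ProperOffZero ∘ decode}
      (encode-proper f f-proper) (all-filter proper? (allFin _))

    best-minimal : ZeroMinimal (decode best)
    best-minimal d d-proper = Extrema.f[argmin]≤v⁺ {f = size} (funToFin f) codes
      (inj₂ (List.lose (∈-filter⁺ proper? (∈-allFin (funToFin d)) (encode-proper d d-proper))
        (p⊆q⇒∣p∣≤∣q∣ (zeros-cong (finToFun-funToFin d)))))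

  module _ {k} {c : Fin n → Fin (suc k)} (c-proper : ProperOffZero c) where

    recolour-zero-proper : ∀ x → ProperOffZero (recolour c x zero)
    recolour-zero-proper x u v a eq with u ≟ x | v ≟ x
    ... | yes refl | _        = updateAt-updates u c
    ... | no _     | yes refl = trans eq (updateAt-updates v c)
    ... | no u≢x   | no v≢x
      rewrite updateAt-minimal u x {const zero} c u≢x
            | updateAt-minimal v x {const zero} c v≢x = c-proper u v a eq

    -- A new monochromatic edge would join `x` to a neighbour already coloured `i`.
    recolour-proper : ∀ {x i} → (∀ w → Adj G x w → c w ≢ i) → ProperOffZero (recolour c x i)
    recolour-proper {x} {i} free u v a eq with u ≟ x | v ≟ x
    ... | yes refl | _        = contradiction
      (trans (sym (updateAt-minimal v u c (Adj⇒≢ a))) (trans (sym eq) (updateAt-updates u c)))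
      (free v a)
    ... | no u≢x   | yes refl = contradiction
      (trans (sym (updateAt-minimal u v c u≢x)) (trans eq (updateAt-updates v c)))
      (free u (Adj-sym a))
    ... | no u≢x   | no v≢x
      rewrite updateAt-minimal u x {const i} c u≢x
            | updateAt-minimal v x {const i} c v≢x = c-proper u v a eq

  -- The exchange step

  module _ {k} {c : Fin n → Fin (suc k)} (c-proper : ProperOffZero c) (c-min : ZeroMinimal c) where

    -- Otherwise `u` could take colour `i` and leave the zero class, against minimality.
    sees-nonzero : ∀ {u} → c u ≡ zero → ∀ i → i ≢ zero →
      ∃[ w ] (Adj G u w × c w ≡ i)
    sees-nonzero {u} cu≡0 i i≢0 with any? (λ w → Adj? u w ×-dec (c w ≟ i))
    ... | yes w = w
    ... | no ∄w = contradiction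
      (c-min d (recolour-proper c-proper λ w a cw≡i → ∄w (w , a , cw≡i)))
      (<⇒≱ (p⊂q⇒∣p∣<∣q∣ (fewer , u , ∈-zeros⁺ c cu≡0 , u∉)))
      where
      d : Fin n → Fin (suc k)
      d = recolour c u i

      u∉ : u ∉ zeros d
      u∉ u∈ = i≢0 (trans (sym (updateAt-updates u c)) (∈-zeros⁻ d u∈))

      fewer : zeros d ⊆ zeros c
      fewer {w} w∈ with w ≟ u
      ... | yes refl = contradiction w∈ u∉
      ... | no w≢u   = ∈-zeros⁺ c (trans (sym (updateAt-minimal w u c w≢u)) (∈-zeros⁻ d w∈))

    module _ {u v} (deg : degree G u ≤ suc k)
             (cu≡0 : c u ≡ zero) (cv≡0 : c v ≡ zero) (u∼v : Adj G u v) where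

      -- All `suc k` colours occur around `u`, `zero` because of `v`. One neighbour of each, plus a
      -- second one of the colour of `x`, would exceed the degree bound.
      neighbour-of-colour-unique : ∀ {x y} → Adj G u x → Adj G u y → c y ≡ c x → y ≡ x
      neighbour-of-colour-unique {x} {y} u∼x u∼y cy≡cx with y ≟ x
      ... | yes y≡x = y≡x
      ... | no y≢x  = contradiction
        (≤-trans (injective⇒≤length-filter (Adj? u) h-injective h-adj) deg) (<⇒≱ ≤-refl)
        where
        -- One neighbour of each colour, with x representing its own colour.
        rep : ∀ i → ∃[ w ] (Adj G u w × c w ≡ i × (c x ≡ i → w ≡ x))
        rep i with i ≟ zero | c x ≟ i
        ... | _        | yes refl = x , u∼x , refl , const refl
        ... | yes refl | no cx≢i = v , u∼v , cv≡0 , λ cx≡i → contradiction cx≡i cx≢i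
        ... | no i≢0   | no cx≢i with w , u∼w , cw≡i ← sees-nonzero cu≡0 i i≢0 =
          w , u∼w , cw≡i , λ cx≡i → contradiction cx≡i cx≢i

        h : Fin (suc (suc k)) → Fin n
        h zero    = y
        h (suc i) = proj₁ (rep i)

        h-adj : ∀ i → Adj G u (h i)
        h-adj zero    = u∼y
        h-adj (suc i) = proj₁ (proj₂ (rep i))

        c-rep : ∀ i → c (proj₁ (rep i)) ≡ i
        c-rep i = proj₁ (proj₂ (proj₂ (rep i)))

        y≢rep : ∀ i → y ≢ proj₁ (rep i)
        y≢rep i eq = y≢x (trans eq (proj₂ (proj₂ (proj₂ (rep i)))
          (trans (sym cy≡cx) (trans (cong c eq) (c-rep i)))))

        h-injective : Injective _≡_ _≡_ h
        h-injective {zero}  {zero}  _  = refl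
        h-injective {zero}  {suc j} eq = contradiction eq (y≢rep j)
        h-injective {suc i} {zero}  eq = contradiction (sym eq) (y≢rep i)
        h-injective {suc i} {suc j} eq =
          cong suc (trans (sym (c-rep i)) (trans (cong c eq) (c-rep j)))

      exchange : ∀ {f : Fin n → Fin (suc k)} → (∀ a b → Adj G a b → f a ≢ f b) → f u ≢ zero →
        ∃[ d ] (ProperOffZero {k} d × ZeroMinimal d × agreement f d ⊃ agreement f c)
      exchange {f} f-proper fu≢0 with x , u∼x , cx≡fu ← sees-nonzero cu≡0 (f u) fu≢0 =
        d , d-proper , d-min , agrees-more , u , ∈-agreement⁺ f d du≡fu , u∉
        where
        -- `x` moves first: it is the only neighbour of `u` coloured `f u`, so afterwards this
        -- colour is free at `u`.
        c₁ d : Fin n → Fin (suc k)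
        c₁ = recolour c x zero
        d  = recolour c₁ u (f u)

        du≡fu : d u ≡ f u
        du≡fu = updateAt-updates u c₁

        d-elsewhere : ∀ {w} → w ≢ u → w ≢ x → d w ≡ c w
        d-elsewhere w≢u w≢x = trans (updateAt-minimal _ u c₁ w≢u) (updateAt-minimal _ x c w≢x)

        d-proper : ProperOffZero d
        d-proper = recolour-proper (recolour-zero-proper c-proper x) fresh
          where
          fresh : ∀ w → Adj G u w → c₁ w ≢ f u
          fresh w u∼w c₁w≡fu with w ≟ x
          ... | yes refl = fu≢0 (trans (sym c₁w≡fu) (updateAt-updates x c))
          ... | no w≢x   = w≢x (neighbour-of-colour-unique u∼x u∼w (trans cw≡fu (sym cx≡fu)))
            where
            cw≡fu : c w ≡ f u
            cw≡fu = trans (sym (updateAt-minimal w x c w≢x)) c₁w≡fu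

        -- `u` leaves the zero class and at most `x` enters it, so the classes are compared with
        -- these vertices removed.
        zeros-d-x⊆zeros-c-u : zeros d - x ⊆ zeros c - u
        zeros-d-x⊆zeros-c-u {w} w∈ with w ≟ u | w ≟ x
        ... | yes refl | _ =
          contradiction (trans (sym du≡fu) (∈-zeros⁻ d (p─q⊆p _ _ w∈))) fu≢0
        ... | no _ | yes refl = contradiction w∈ (x∉p-x (zeros d) x)
        ... | no w≢u | no w≢x = x∈p∧x≢y⇒x∈p-y
          (∈-zeros⁺ c (trans (sym (d-elsewhere w≢u w≢x))
            (∈-zeros⁻ d (p─q⊆p _ _ w∈)))) w≢u

        ∣zeros-d∣≤∣zeros-c∣ : ∣ zeros d ∣ ≤ ∣ zeros c ∣
        ∣zeros-d∣≤∣zeros-c∣ = begin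
          ∣ zeros d ∣           ≤⟨ ∣p∣≤1+∣p-x∣ (zeros d) x ⟩
          suc ∣ zeros d - x ∣   ≤⟨ s≤s (p⊆q⇒∣p∣≤∣q∣ zeros-d-x⊆zeros-c-u) ⟩
          suc ∣ zeros c - u ∣   ≤⟨ x∈p⇒∣p-x∣<∣p∣ (∈-zeros⁺ c cu≡0) ⟩
          ∣ zeros c ∣           ∎
          where open ≤-Reasoning

        d-min : ZeroMinimal d
        d-min e e-proper = ≤-trans ∣zeros-d∣≤∣zeros-c∣ (c-min e e-proper)

        u∉ : u ∉ agreement f c
        u∉ u∈ = fu≢0 (trans (sym (∈-agreement⁻ f c u∈)) cu≡0)

        -- Only `u` and `x` change colour, and `c` disagreed with `f` at both.
        agrees-more : agreement f c ⊆ agreement f d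
        agrees-more {w} w∈ with w ≟ u | w ≟ x
        ... | yes refl | _        = contradiction w∈ u∉
        ... | no _     | yes refl = contradiction
          (trans (sym cx≡fu) (∈-agreement⁻ f c w∈)) (f-proper u x u∼x)
        ... | no w≢u   | no w≢x   = ∈-agreement⁺ f d
          (trans (d-elsewhere w≢u w≢x) (∈-agreement⁻ f c w∈))

  -- Iterating the exchange

  ZeroIndependent : ∀ {k} → (Fin n → Fin (suc k)) → Set
  ZeroIndependent c = ∀ u v → Adj G u v → c u ≡ zero → c v ≢ zero

  module _ {k} (deg : ∀ u → degree G u ≤ suc k)
           {f : Fin n → Fin (suc k)} (f-proper : ∀ u v → Adj G u v → f u ≢ f v) where

    improve : ∀ {c} → ProperOffZero c → ZeroMinimal c → Acc _⊃_ (agreement f c) →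
      ∃[ d ] (ProperOffZero {k} d × ZeroMinimal d × ZeroIndependent d)
    improve {c} c-proper c-min (acc rec)
      with any? (λ u → any? λ v → Adj? u v ×-dec ((c u ≟ zero) ×-dec (c v ≟ zero)))
    ... | no ∄uv = c , c-proper , c-min , λ u v a cu≡0 cv≡0 → ∄uv (u , v , a , cu≡0 , cv≡0)
    ... | yes (u , v , u∼v , cu≡0 , cv≡0) with f u ≟ zero
    ...   | no fu≢0
      with d , d-proper , d-min , d⊃c ← exchange c-proper c-min (deg u) cu≡0 cv≡0 u∼v f-proper fu≢0 =
      improve d-proper d-min (rec d⊃c)
    -- `f` separates the adjacent `u` and `v`, so `f v` is nonzero and the two swap roles.
    ...   | yes fu≡0
      with d , d-proper , d-min , d⊃c ← exchange c-proper c-min (deg v) cv≡0 cu≡0 (Adj-sym u∼v) f-proper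
             (λ fv≡0 → f-proper u v u∼v (trans fu≡0 (sym fv≡0))) =
      improve d-proper d-min (rec d⊃c)

    ∃-zeroMinimal-zeroIndependent :
      ∃[ c ] (ProperOffZero {k} c × ZeroMinimal c × ZeroIndependent c)
    ∃-zeroMinimal-zeroIndependent
      with c , c-proper , c-min ← ∃-zeroMinimal (λ u v a eq → contradiction eq (f-proper u v a)) =
      improve c-proper c-min (⊃-wellFounded _)

  -- Translation to deletion sets

  colourableMinus⇒properOffZero : ∀ {S k} → ColorableMinus G S k →
    ∃[ c ] (ProperOffZero {k} c × zeros c ⊆ S)
  colourableMinus⇒properOffZero {S} {k} (d , d-proper) = c , c-proper , zeros⊆S
    where
    c : Fin n → Fin (suc k)
    c v with v ∈? S
    ... | yes _ = zero
    ... | no _  = suc (d v)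

    c-proper : ProperOffZero c
    c-proper u v a eq with u ∈? S | v ∈? S
    ... | yes _  | _      = refl
    ... | no u∉S | no v∉S = contradiction (suc-injective eq) (d-proper u v u∉S v∉S a)

    zeros⊆S : zeros c ⊆ S
    zeros⊆S {v} v∈ with v ∈? S | ∈-zeros⁻ c v∈
    ... | yes v∈S | _ = v∈S

  properOffZero⇒colourableMinus : ∀ {k} {c : Fin n → Fin (suc (suc k))} → ProperOffZero c →
    ColorableMinus G (zeros c) (suc k)
  properOffZero⇒colourableMinus {k} {c} c-proper = pred′ ∘ c , λ u v u∉ v∉ a eq →
    u∉ (∈-zeros⁺ c (c-proper u v a (pred′-injective (∉⇒≢0 u∉) (∉⇒≢0 v∉) eq)))
    where
    ∉⇒≢0 : ∀ {v} → v ∉ zeros c → c v ≢ zero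
    ∉⇒≢0 v∉ = v∉ ∘ ∈-zeros⁺ c

    pred′ : Fin (suc (suc k)) → Fin (suc k)
    -- Deleted vertices also need some colour; this arbitrary value is why at least one nonzero
    -- colour must exist.
    pred′ zero    = zero
    pred′ (suc i) = i

    pred′-injective : ∀ {i j} → i ≢ zero → j ≢ zero → pred′ i ≡ pred′ j → i ≡ j
    pred′-injective {zero}          i≢0 _   _  = contradiction refl i≢0
    pred′-injective {suc _} {zero}  _   j≢0 _  = contradiction refl j≢0
    pred′-injective {suc _} {suc _} _   _   eq = cong suc eq

  -- `S` can serve as one extra colour class, so deleting an independent set lowers the chromatic
  -- number by at most one.
  independent⇒colourable-suc : ∀ {S j} → Independent G S → ColorableMinus G S j →
    ColorableMinus G ∅ (suc j)
  independent⇒colourable-suc {S} S-indep col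
    with c , c-proper , zeros⊆S ← colourableMinus⇒properOffZero col =
    c , λ u v _ _ a eq → let cu≡0 = c-proper u v a eq in
      S-indep u v
        (zeros⊆S (∈-zeros⁺ c cu≡0))
        (zeros⊆S (∈-zeros⁺ c (trans (sym eq) cu≡0)))
        a

  module _ {k} {c : Fin n → Fin (suc (suc k))} where

    zeros-independent : ZeroIndependent c → Independent G (zeros c)
    zeros-independent c-indep u v u∈ v∈ a = c-indep u v a (∈-zeros⁻ c u∈) (∈-zeros⁻ c v∈)

    zeros-reduces : Chromatic G (suc (suc k)) → ProperOffZero c → ZeroIndependent c →
      Reduces G (zeros c)
    zeros-reduces (col , least) c-proper c-indep k′ (col′ , least′)
      -- `Reduces` ranges over every chromatic number `k′`; minimality on both sides identifies it
      -- with `suc (suc k)`.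
      with refl ← ≤-antisym (least′ _ col) (least k′ col′) =
      properOffZero⇒colourableMinus c-proper ,
      λ j colⱼ → s≤s⁻¹ (least (suc j) (independent⇒colourable-suc (zeros-independent c-indep) colⱼ))

    -- A reducing set, independent or not, yields an admissible map whose zero class it contains;
    -- hence one bound serves both stability numbers.
    zeroMinimal⇒≤reduces : Chromatic G (suc (suc k)) → ZeroMinimal c →
      ∀ S → Reduces G S → ∣ zeros c ∣ ≤ ∣ S ∣
    zeroMinimal⇒≤reduces χ c-min S S-reduces
      with d , d-proper , zeros⊆S ← colourableMinus⇒properOffZero (proj₁ (S-reduces _ χ)) =
      ≤-trans (c-min d d-proper) (p⊆q⇒∣p∣≤∣q∣ zeros⊆S)

theorem1p1 : ∀ (n : ℕ) (G : Graph n) (k : ℕ) → HasEdge G → Chromatic G k →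
    (k ≡ maxDegree G ⊎ k ≡ suc (maxDegree G)) →
    ∃[ m ] (IsVS G m × IsIVS G m)
theorem1p1 n G zero (u , _) ((f , _) , _) _ = contradiction (f u) λ ()
theorem1p1 n G (suc zero) (u , v , u∼v) ((f , f-proper) , _) _
  with f u | f v | f-proper u v ∉⊥ ∉⊥ u∼v
... | zero | zero | 0≢0 = contradiction refl 0≢0
theorem1p1 n G k@(suc (suc _)) _ χ@((f , f-proper) , _) k≡Δ⊎k≡1+Δ =
  -- Both alternatives give Δ ≤ k, the degree bound that the exchange relies on.
  let Δ≤k = [ ≤-reflexive ∘ sym , (λ k≡1+Δ → ≤-trans (n≤1+n _) (≤-reflexive (sym k≡1+Δ))) ]′ k≡Δ⊎k≡1+Δ
      c , c-proper , c-min , c-indep = ∃-zeroMinimal-zeroIndependent G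
        (λ v → ≤-trans (degree≤maxDegree G v) Δ≤k) (λ u v → f-proper u v ∉⊥ ∉⊥)
      reduces = zeros-reduces G {c = c} χ c-proper c-indep
      minimal = zeroMinimal⇒≤reduces G {c = c} χ c-min
  in ∣ zeros c ∣ ,
     ((zeros c , refl , reduces) , minimal) ,
     ((zeros c , refl , zeros-independent G {c = c} c-indep , reduces) , λ S _ → minimal S)
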